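{- Let $n\ge 1$ be an integer. If the $4n$ vertices of the graph $K_{1,3}\times P_n$ are colored uniformly and independently with two colors, the expected number of blocks is $$\mathbb{E}[X_2(K_{1,3}\times P_n)]=\frac{2254219}{1411200}+\frac{6}{49}2^{ -3n}-\frac{2}{225}2^{ -4n}+\frac{11933}{13440}n.$$
   Context: $K_{1,3}$ is the star graph (complete bipartite graph with parts of sizes $1$ and $3$) and $P_n$ the path graph on $n$ vertices. The product $G_1\times G_2$ of graphs $G_1=(V_1,E_1)$, $G_2=(V_2,E_2)$ is the Cartesian product: its vertex set is $V_1\times V_2$, and $(v_1,v_2),(w_1,w_2)$ are adjacent iff ($v_1=w_1$ and $\{v_2,w_2\}\in E_2$) or ($v_2=w_2$ and $\{v_1,w_1\}\in E_1$). Given a coloring of the vertices of a finite graph $G$ with $k$ colors, the blocks are the connected components of the subgraph of $G$ formed by all vertices and all edges whose two endpoints have the same color. $X_k(G)$ denotes the number of blocks when each vertex of $G$ receives independently a uniformly random color among $k$ colors. -}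

module Defs where

open import Data.Fin using (Fin; toℕ; finToFun)
open import Data.Fin.Properties using (+↔⊎; *↔×; inj⇒≟) renaming (_≟_ to _≟ᶠ_)
open import Data.Integer using (+_)
open import Data.List using (List; []; _∷_; allFin; deduplicate; length; map)
open import Data.List.Membership.Propositional using (_∈_)
open import Data.List.Membership.Propositional.Properties using (∈-allFin; ∈-map⁺)
open import Data.List.Relation.Unary.Any using (here; there)
open import Data.Nat using (ℕ; suc; _+_; _*_; _^_; NonZero)
open import Data.Nat.Properties using (+-0-commutativeMonoid; m^n≢0; 1+n≢n; _≟_)
open import Data.Product using (_×_; _,_)
open import Data.Product.Function.NonDependent.Propositional using (_×-↔_)
open import Data.Rational using (ℚ; _/_)
open import Data.Sum using (_⊎_; inj₁; inj₂; swap)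
open import Data.Unit using (⊤; tt)
open import Data.Empty using (⊥)
open import Function using (_∘_)
open import Function.Bundles using (_↔_; Inverse)
open import Function.Construct.Composition using (_↔-∘_)
open import Function.Construct.Identity using (↔-id)
open import Function.Construct.Symmetry using (↔-sym)
open import Function.Properties.Inverse using (↔⇒↣)
open import Relation.Binary.Construct.Closure.ReflexiveTransitive using (Star; ε; _◅_; _◅◅_)
open import Relation.Binary.Definitions using (Decidable; DecidableEquality; Irreflexive; Symmetric)
open import Relation.Binary.PropositionalEquality using (_≡_; refl; sym; subst)
open import Relation.Nullary using (yes; no)
open import Relation.Nullary.Decidable using (_×-dec_; _⊎-dec_; map′)
open import Algebra.Properties.CommutativeMonoid.Sum +-0-commutativeMonoid using (sum)

record Graph : Set₁ where
  field
    V          : Set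
    order      : ℕ
    label      : V ↔ Fin order
    Adj        : V → V → Set
    adj?       : Decidable Adj
    adj-sym    : Symmetric Adj
    adj-irrefl : Irreflexive _≡_ Adj

  open Inverse label using (to; from; strictlyInverseʳ) public

  _≟ⱽ_ : DecidableEquality V
  _≟ⱽ_ = inj⇒≟ (↔⇒↣ label)

  vertices : List V
  vertices = map from (allFin order)

  Connected : V → V → Set
  Connected = Star Adj

  -- Decidability of Connected, by Warshall's algorithm: Via ws u v says that
  -- v is reachable from u with all intermediate vertices in ws.

  Via : List V → V → V → Set
  Via []       u v = u ≡ v ⊎ Adj u v
  Via (w ∷ ws) u v = Via ws u v ⊎ (Via ws u w × Via ws w v)

  via? : ∀ ws → Decidable (Via ws)
  via? []       u v = (u ≟ⱽ v) ⊎-dec adj? u v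
  via? (w ∷ ws) u v = via? ws u v ⊎-dec (via? ws u w ×-dec via? ws w v)

  via⇒connected : ∀ ws {u v} → Via ws u v → Connected u v
  via⇒connected []       (inj₁ refl)    = ε
  via⇒connected []       (inj₂ a)       = a ◅ ε
  via⇒connected (w ∷ ws) (inj₁ p)       = via⇒connected ws p
  via⇒connected (w ∷ ws) (inj₂ (p , q)) = via⇒connected ws p ◅◅ via⇒connected ws q

  []⇒via : ∀ ws {u v} → Via [] u v → Via ws u v
  []⇒via []       p = p
  []⇒via (w ∷ ws) p = inj₁ ([]⇒via ws p)

  via-trans : ∀ {ws u w v} → w ∈ ws → Via ws u w → Via ws w v → Via ws u v
  via-trans (here refl) p q = inj₂ (toHead p , fromHead q)
    where
    toHead : ∀ {w ws u} → Via (w ∷ ws) u w → Via ws u w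
    toHead (inj₁ p)       = p
    toHead (inj₂ (p , _)) = p
    fromHead : ∀ {w ws v} → Via (w ∷ ws) w v → Via ws w v
    fromHead (inj₁ q)       = q
    fromHead (inj₂ (_ , q)) = q
  via-trans (there w∈) (inj₁ p)       (inj₁ q)       = inj₁ (via-trans w∈ p q)
  via-trans (there w∈) (inj₁ p)       (inj₂ (q , r)) = inj₂ (via-trans w∈ p q , r)
  via-trans (there w∈) (inj₂ (p , q)) (inj₁ r)       = inj₂ (p , via-trans w∈ q r)
  via-trans (there w∈) (inj₂ (p , _)) (inj₂ (_ , r)) = inj₂ (p , r)

  ∈-vertices : ∀ v → v ∈ vertices
  ∈-vertices v = subst (_∈ vertices) (strictlyInverseʳ v) (∈-map⁺ from (∈-allFin (to v)))

  connected⇒via : ∀ {u v} → Connected u v → Via vertices u v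
  connected⇒via ε       = []⇒via vertices (inj₁ refl)
  connected⇒via (a ◅ s) = via-trans (∈-vertices _) ([]⇒via vertices (inj₂ a)) (connected⇒via s)

  connected? : Decidable Connected
  connected? u v = map′ (via⇒connected vertices) connected⇒via (via? vertices u v)

  -- deduplicate keeps exactly one vertex of each class of Connected.
  #components : ℕ
  #components = length (deduplicate connected? vertices)

open Graph using (V; order; label)

K : ℕ → ℕ → Graph
K a b = record
  { V          = Fin a ⊎ Fin b
  ; order      = a + b
  ; label      = ↔-sym +↔⊎
  ; Adj        = Adj
  ; adj?       = adj?
  ; adj-sym    = λ {x} {y} → adj-sym {x} {y}
  ; adj-irrefl = λ {x} {y} → adj-irrefl {x} {y}
  }
  where
  Adj : Fin a ⊎ Fin b → Fin a ⊎ Fin b → Set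
  Adj (inj₁ _) (inj₁ _) = ⊥
  Adj (inj₁ _) (inj₂ _) = ⊤
  Adj (inj₂ _) (inj₁ _) = ⊤
  Adj (inj₂ _) (inj₂ _) = ⊥

  adj? : Decidable Adj
  adj? (inj₁ _) (inj₁ _) = no λ ()
  adj? (inj₁ _) (inj₂ _) = yes tt
  adj? (inj₂ _) (inj₁ _) = yes tt
  adj? (inj₂ _) (inj₂ _) = no λ ()

  adj-sym : Symmetric Adj
  adj-sym {inj₁ _} {inj₂ _} _ = tt
  adj-sym {inj₂ _} {inj₁ _} _ = tt

  adj-irrefl : Irreflexive _≡_ Adj
  adj-irrefl {inj₁ _} refl ()
  adj-irrefl {inj₂ _} refl ()

P : ℕ → Graph
P n = record
  { V          = Fin n
  ; order      = n
  ; label      = ↔-id (Fin n)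
  ; Adj        = λ i j → suc (toℕ i) ≡ toℕ j ⊎ suc (toℕ j) ≡ toℕ i
  ; adj?       = λ i j → (suc (toℕ i) ≟ toℕ j) ⊎-dec (suc (toℕ j) ≟ toℕ i)
  ; adj-sym    = swap
  ; adj-irrefl = λ { refl (inj₁ e) → 1+n≢n e ; refl (inj₂ e) → 1+n≢n e }
  }

infixr 7 _□_

_□_ : Graph → Graph → Graph
G □ H = record
  { V          = G.V × H.V
  ; order      = G.order * H.order
  ; label      = ↔-sym *↔× ↔-∘ (G.label ×-↔ H.label)
  ; Adj        = λ (v₁ , v₂) (w₁ , w₂) → (v₁ ≡ w₁ × H.Adj v₂ w₂) ⊎ (v₂ ≡ w₂ × G.Adj v₁ w₁)
  ; adj?       = λ (v₁ , v₂) (w₁ , w₂) → ((v₁ G.≟ⱽ w₁) ×-dec H.adj? v₂ w₂)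
                                         ⊎-dec ((v₂ H.≟ⱽ w₂) ×-dec G.adj? v₁ w₁)
  ; adj-sym    = λ { (inj₁ (e , a)) → inj₁ (sym e , H.adj-sym a)
                   ; (inj₂ (e , a)) → inj₂ (sym e , G.adj-sym a) }
  ; adj-irrefl = λ { refl (inj₁ (_ , a)) → H.adj-irrefl refl a
                   ; refl (inj₂ (_ , a)) → G.adj-irrefl refl a }
  }
  where
  module G = Graph G
  module H = Graph H

Colouring : ℕ → Graph → Set
Colouring k G = V G → Fin k

monochromatic : ∀ {k} (G : Graph) → Colouring k G → Graph
monochromatic G c = record
  { V          = G.V
  ; order      = G.order
  ; label      = G.label
  ; Adj        = λ u v → G.Adj u v × c u ≡ c v
  ; adj?       = λ u v → G.adj? u v ×-dec (c u ≟ᶠ c v)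
  ; adj-sym    = λ (a , e) → G.adj-sym a , sym e
  ; adj-irrefl = λ e (a , _) → G.adj-irrefl e a
  }
  where module G = Graph G

#blocks : ∀ {k} (G : Graph) → Colouring k G → ℕ
#blocks G c = Graph.#components (monochromatic G c)

-- finToFun enumerates each map Fin (order G) → Fin k exactly once (up to
-- pointwise equality), so this lists all k ^ order G colourings.
colouring : ∀ k (G : Graph) → Fin (k ^ order G) → Colouring k G
colouring k G i = finToFun i ∘ Inverse.to (label G)

-- Independent uniform vertex colours make every colouring equally likely,
-- with probability 1 / k ^ order G.
𝔼 : ∀ k .{{_ : NonZero k}} (G : Graph) → (Colouring k G → ℕ) → ℚ
𝔼 k G X = (+ sum (X ∘ colouring k G) / (k ^ order G)) {{m^n≢0 k (order G)}}

𝔼[X_] : ∀ k .{{_ : NonZero k}} → Graph → ℚ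
𝔼[X k ] G = 𝔼 k G (#blocks G)

infix 8 2^-_

2^-_ : ℕ → ℚ
2^- m = (+ 1 / (2 ^ m)) {{m^n≢0 2 m}}

{-# OPTIONS --safe #-}

-- Add the columns one at a time.  A new column brings four vertices, and every
-- monochromatic edge inside it or to the previous column lowers the number of blocks by
-- one unless its ends are already connected.  Hence #blocks = 4n − rank, where the
-- increase of the rank depends only on the new colours and on the state of the previous
-- column: its colours and the partition of its vertices by connectedness.  There are 30
-- states, and summed over the next two columns the increase depends only on the number of
-- classes (1, 2 or 3) among the three leaves.  The numbers of colourings with one and with
-- two leaf classes satisfy a linear recurrence with eigenvalues 16, 2 and 1.
module Submission where

open import Defs
import Algebra.Properties.Semiring.Sum as SemiringSum
open import Data.Bool using (if_then_else_)
open import Data.Fin using (Fin; zero; suc; toℕ; splitAt; join; _↑ˡ_; _↑ʳ_; combine; remQuot; finToFun; funToFin; punchIn; punchOut)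
open import Data.Fin.Patterns
open import Data.Fin.Permutation using (Permutation)
open import Data.Fin.Properties using (injective⇒≤; toℕ-injective; toℕ<n; punchInᵢ≢i; punchOut-injective; punchOut-cong; punchOut-punchIn; ↑ˡ-injective; ↑ʳ-injective; splitAt-↑ˡ; splitAt-↑ʳ; join-splitAt; splitAt-join; combine-remQuot; remQuot-combine; funToFin-finToFin; finToFun-funToFin) renaming (_≟_ to _≟ᶠ_; all? to allᶠ?)
open import Data.List using (List; []; _∷_; allFin; cartesianProduct; deduplicate; filter; length) renaming (lookup to lookupᴸ; map to mapᴸ; _++_ to _++ᴸ_)
import Data.List.Membership.DecPropositional as Membership
open import Data.List.Membership.Propositional using (_∈_; lose)
open import Data.List.Membership.Propositional.Properties using (∈-lookup; ∈-filter⁺; ∈-filter⁻; ∈-++⁺ˡ; ∈-++⁺ʳ)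
open import Data.List.Relation.Unary.All as All using (All; []; _∷_)
open import Data.List.Relation.Unary.AllPairs using (AllPairs; []; _∷_)
open import Data.List.Relation.Unary.Any as Any using (Any; here; there)
import Data.List.Relation.Unary.Any.Properties as Any
open import Data.List.Relation.Unary.Unique.DecSetoid.Properties using (deduplicate-!)
open import Data.Nat using (zero; suc; _^_; _≟_; _≡ᵇ_; z≤n; s≤s; NonZero)
open import Data.Nat.Properties using (+-*-semiring; ≤-antisym; ≤-trans; <⇒≢; m≤m+n; m^n≢0; ^-distribˡ-+-*; suc-injective)
open import Data.Nat.Tactic.RingSolver using (solve-∀)
open import Data.Product using (Σ; ∃; _×_; _,_; proj₁; proj₂; uncurry)
open import Data.Product.Properties using (≡-dec)
open import Data.Sum using (_⊎_; inj₁; inj₂; [_,_]′) renaming (map to map⊎)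
open import Data.Unit using (tt)
open import Data.Vec using (Vec; []; _∷_; _++_; lookup; map; tabulate; take; toList)
open import Data.Vec.Properties using (lookup-map; lookup-splitAt; lookup∘tabulate; tabulate∘lookup; tabulate-cong) renaming (≡-dec to ≡-decⱽ)
open import Function using (_∘_; _⇔_; mk⇔; mk↔ₛ′; Equivalence; Inverse)
open import Level using (0ℓ)
open import Relation.Binary.Bundles using (DecSetoid)
open import Relation.Binary.Construct.Closure.ReflexiveTransitive as Star using (ε; _◅_; _◅◅_)
import Relation.Binary.Construct.Closure.ReflexiveTransitive.Properties as Star
open import Relation.Binary.Definitions using (DecidableEquality; Symmetric; Transitive)
open import Relation.Binary.PropositionalEquality using (_≢_; _≗_; refl; sym; trans; cong; cong₂; subst; subst₂; module ≡-Reasoning)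
open import Relation.Nullary using (¬_; yes; no; does; contradiction)
open import Relation.Nullary.Decidable using (True; from-yes; toWitness)
open import Relation.Unary using (Decidable)
open import Data.Nat using (ℕ; _≥_) renaming (_*_ to _*ℕ_)
open import Relation.Binary.PropositionalEquality using (_≡_)

open SemiringSum +-*-semiring using (sum; sum-cong-≗; ∑-distrib-+; sum-permute; *-distribˡ-sum)
open ≡-Reasoning

-- Why the leaf classes suffice: a leaf with the colour of its centre is adjacent to it, so the
-- class of the centre meets the leaves exactly in those of its colour, and only the partition of
-- the other leaves carries history. This gives 2 * (1 + 3 * 1 + 3 * 2 + 5) = 30 states, the factors
-- 1, 1, 2, 5 being the Bell numbers. Two new leaves of colour b are connected either through a new
-- centre of colour b, or because their old neighbours also have colour b and were connected
-- already. Hence a state with three leaf classes leaves no trace: the next state is that of a lone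
-- column. Which colour a joined set of leaves has is irrelevant once all 16 colourings of the next
-- column are summed. Why two columns are needed: the increase in the very next column also feels
-- which old leaves have the colour of the old centre, since each of them can close a monochromatic
-- square. In the column after that, these squares are governed by colours that have been summed
-- over.

module Transfer where
  open import Data.Nat using (_+_; _*_)
  open import Data.Nat.Properties using (+-assoc; +-comm; +-identityʳ; +-cancelˡ-≡; +-cancelʳ-≡; *-suc)

  -- Connected components are counted as the classes of a surjection V → Fin m whose
  -- kernel equals ~.  Only "kernel ⊆ ~" is built in: while edges are being added one
  -- at a time, the kernel is still too fine.
  record Classes {V : Set} (_~_ : V → V → Set) (m : ℕ) : Set where
    field
      class     : V → Fin m
      rep       : Fin m → V
      class-rep : ∀ i → class (rep i) ≡ i
      class⇒~   : ∀ {u v} → class u ≡ class v → u ~ v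

  open Classes

  -- Components counted by classes.

  lookup-injective : ∀ {A : Set} {_~_ : A → A → Set} → Symmetric _~_ →
    ∀ {xs} → AllPairs (λ x y → ¬ x ~ y) xs → ∀ {i j} → lookupᴸ xs i ~ lookupᴸ xs j → i ≡ j
  lookup-injective s {x ∷ xs} (_ ∷ _)  {zero}  {zero}  _ = refl
  lookup-injective s {x ∷ xs} (p ∷ _)  {zero}  {suc j} r = contradiction r (All.lookup p (∈-lookup j))
  lookup-injective s {x ∷ xs} (p ∷ _)  {suc i} {zero}  r = contradiction (s r) (All.lookup p (∈-lookup i))
  lookup-injective s {x ∷ xs} (_ ∷ ps) {suc i} {suc j} r = cong suc (lookup-injective s ps r)

  module _ (G : Graph) where
    open Graph G

    connected-decSetoid : DecSetoid 0ℓ 0ℓ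
    connected-decSetoid = record
      { Carrier = V
      ; _≈_ = Connected
      ; isDecEquivalence = record
        { isEquivalence = record { refl = ε ; sym = Star.reverse adj-sym ; trans = _◅◅_ }
        ; _≟_ = connected?
        }
      }

    -- Two injections. Representatives in one class would be connected, which `deduplicate`
    -- excludes. Conversely every class keeps a representative: `deduplicate` may replace `rep q i`
    -- only by a vertex connected to it, and `adj⇒class` keeps that vertex in the same class.
    #components≡#classes : ∀ {m} (q : Classes Connected m) →
      (∀ {u v} → Adj u v → class q u ≡ class q v) → #components ≡ m
    #components≡#classes {m} q adj⇒class = ≤-antisym
      (injective⇒≤ {f = class q ∘ lookupᴸ reps}
        (lookup-injective (Star.reverse adj-sym) (deduplicate-! connected-decSetoid vertices) ∘ class⇒~ q))
      (injective⇒≤ {f = Any.index ∘ representative} λ {i} {j} e →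
        trans (sym (Any.lookup-index (representative i)))
          (trans (cong (class q ∘ lookupᴸ reps) e) (Any.lookup-index (representative j))))
      where
      reps : List V
      reps = deduplicate connected? vertices

      connected⇒class : ∀ {u v} → Connected u v → class q u ≡ class q v
      connected⇒class = Star.fold (λ u v → class q u ≡ class q v) (λ a → trans (adj⇒class a)) refl

      representative : ∀ i → Any (λ v → class q v ≡ i) reps
      representative i = Any.deduplicate⁺ connected? (λ c → trans (connected⇒class c))
        (lose (∈-vertices (rep q i)) (class-rep q i))

  -- Contracting edges on integer labels.

  Glued : {A : Set} → A → A → A → A → Set
  Glued u v x y = x ≡ y ⊎ (x ≡ u × y ≡ v) ⊎ (x ≡ v × y ≡ u)

  module _ {A : Set} (_≟_ : DecidableEquality A) where

    collapse : A → A → A → A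
    collapse u v x = if does (x ≟ v) then u else x

    collapse-kernel : ∀ {u v x y} → collapse u v x ≡ collapse u v y ⇔ Glued u v x y
    collapse-kernel {u} {v} {x} {y} = mk⇔ ⇒ ⇐
      where
      ⇒ : collapse u v x ≡ collapse u v y → Glued u v x y
      ⇒ e with x ≟ v | y ≟ v
      ... | yes p | yes q = inj₁ (trans p (sym q))
      ... | yes p | no  _ = inj₂ (inj₂ (p , sym e))
      ... | no  _ | yes q = inj₂ (inj₁ (e , q))
      ... | no  _ | no  _ = inj₁ e

      ⇐ : Glued u v x y → collapse u v x ≡ collapse u v y
      ⇐ (inj₁ refl) = refl
      ⇐ (inj₂ (inj₁ (refl , refl))) with u ≟ v | v ≟ v
      ... | yes _ | yes _ = refl
      ... | no  _ | yes _ = refl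
      ... | _     | no ¬p = contradiction refl ¬p
      ⇐ (inj₂ (inj₂ (refl , refl))) with u ≟ v | v ≟ v
      ... | yes _ | yes _ = refl
      ... | no  _ | yes _ = refl
      ... | _     | no ¬p = contradiction refl ¬p

    collapse-≢ : ∀ {u v} → u ≢ v → ∀ x → v ≢ collapse u v x
    collapse-≢ {u} {v} u≢v x with x ≟ v
    ... | yes _ = u≢v ∘ sym
    ... | no ¬p = ¬p ∘ sym

    collapse-id : ∀ {u v x} → x ≢ v → collapse u v x ≡ x
    collapse-id {u} {v} {x} x≢v with x ≟ v
    ... | yes p = contradiction p x≢v
    ... | no  _ = refl

  Fin⇒suc : ∀ {m} → Fin m → ∃ λ k → m ≡ suc k
  Fin⇒suc {suc k} _ = k , refl

  module _ {N : ℕ} where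

    Edge : Set
    Edge = Fin N × Fin N

    contract : Edge → Vec ℕ N → Vec ℕ N
    contract (i , j) ls = map (collapse _≟_ (lookup ls i) (lookup ls j)) ls

    gain : Edge → Vec ℕ N → ℕ
    gain (i , j) ls = if does (lookup ls i ≟ lookup ls j) then 0 else 1

    contractAll : List Edge → Vec ℕ N → Vec ℕ N
    contractAll []       ls = ls
    contractAll (e ∷ es) ls = contractAll es (contract e ls)

    -- The rank in the graphic matroid, after points with equal labels are identified: it counts the
    -- edges that a greedy spanning forest keeps.
    rank : List Edge → Vec ℕ N → ℕ
    rank []       ls = 0
    rank (e ∷ es) ls = gain e ls + rank es (contract e ls)

    module _ {V : Set} {_~_ : V → V → Set} (~-sym : Symmetric _~_) (~-trans : Transitive _~_)
             (x : Fin N → V) where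

      LabelledBy : ∀ {m} → Classes _~_ m → Vec ℕ N → Set
      LabelledBy q ls = ∀ i j → class q (x i) ≡ class q (x j) ⇔ lookup ls i ≡ lookup ls j

      -- The relation `_~_` stays fixed (later: connectedness in the whole graph), so no
      -- intermediate subgraph has to be formed. `joined` accounts for the edges just added, and
      -- `coarser` preserves what earlier edges achieved; together they later yield `resp`, the
      -- missing half of "kernel equals connectedness".
      record Coarsening {m : ℕ} (q : Classes _~_ m) (es : List Edge) (ls : Vec ℕ N) : Set where
        field
          {size}   : ℕ
          classes  : Classes _~_ size
          size-+   : size + rank es ls ≡ m
          coarser  : ∀ {u v} → class q u ≡ class q v → class classes u ≡ class classes v
          labels   : LabelledBy classes (contractAll es ls)
          joined   : ∀ {i j} → (i , j) ∈ es → class classes (x i) ≡ class classes (x j)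

      open Coarsening
      open Equivalence

      -- Redirecting the class of `v` to that of `u` leaves the index `class q v` without preimage;
      -- `punchOut` closes this gap, so exactly one class is lost.
      merge : ∀ {m} (q : Classes _~_ (suc m)) {u v} → u ~ v → class q u ≢ class q v →
        Σ (Classes _~_ m) λ q′ → ∀ a b →
          class q′ a ≡ class q′ b ⇔ Glued (class q u) (class q v) (class q a) (class q b)
      merge {m} q {u} {v} u~v u≢v = q′ , kernel
        where
        avoids : ∀ w → class q v ≢ collapse _≟ᶠ_ (class q u) (class q v) (class q w)
        avoids w = collapse-≢ _≟ᶠ_ u≢v (class q w)

        kernel : ∀ a b → punchOut (avoids a) ≡ punchOut (avoids b) ⇔
          Glued (class q u) (class q v) (class q a) (class q b)
        kernel a b = mk⇔
          (to (collapse-kernel _≟ᶠ_) ∘ punchOut-injective (avoids a) (avoids b))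
          (punchOut-cong (class q v) ∘ from (collapse-kernel _≟ᶠ_))

        related : ∀ {a b} → Glued (class q u) (class q v) (class q a) (class q b) → a ~ b
        related (inj₁ e)                = class⇒~ q e
        related (inj₂ (inj₁ (e₁ , e₂))) = ~-trans (class⇒~ q e₁) (~-trans u~v (class⇒~ q (sym e₂)))
        related (inj₂ (inj₂ (e₁ , e₂))) = ~-trans (class⇒~ q e₁) (~-trans (~-sym u~v) (class⇒~ q (sym e₂)))

        q′ : Classes _~_ m
        q′ = record
          { class     = λ w → punchOut (avoids w)
          ; rep       = rep q ∘ punchIn (class q v)
          ; class-rep = λ i → trans
              (punchOut-cong (class q v) (trans (cong (collapse _≟ᶠ_ _ _) (class-rep q _))
                (collapse-id _≟ᶠ_ (punchInᵢ≢i (class q v) i))))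
              (punchOut-punchIn (class q v))
          ; class⇒~   = λ {a} {b} → related ∘ to (kernel a b)
          }

      contract-labels : ∀ {m m′} (q : Classes _~_ m) (q′ : Classes _~_ m′) ls i j → LabelledBy q ls →
        (∀ a b → class q′ a ≡ class q′ b ⇔
          Glued (class q (x i)) (class q (x j)) (class q a) (class q b)) →
        LabelledBy q′ (contract (i , j) ls)
      contract-labels q q′ ls i j lab kernel a b =
        subst₂ (λ s t → class q′ (x a) ≡ class q′ (x b) ⇔ s ≡ t) (sym (lookup-map a _ ls)) (sym (lookup-map b _ ls))
          (mk⇔ (from (collapse-kernel _≟_) ∘ ⇒ ∘ to (kernel _ _))
               (from (kernel _ _) ∘ ⇐ ∘ to (collapse-kernel _≟_)))
        where
        ⇒ : Glued (class q (x i)) (class q (x j)) (class q (x a)) (class q (x b)) →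
            Glued (lookup ls i) (lookup ls j) (lookup ls a) (lookup ls b)
        ⇒ (inj₁ e)              = inj₁ (to (lab _ _) e)
        ⇒ (inj₂ (inj₁ (e , f))) = inj₂ (inj₁ (to (lab _ _) e , to (lab _ _) f))
        ⇒ (inj₂ (inj₂ (e , f))) = inj₂ (inj₂ (to (lab _ _) e , to (lab _ _) f))

        ⇐ : Glued (lookup ls i) (lookup ls j) (lookup ls a) (lookup ls b) →
            Glued (class q (x i)) (class q (x j)) (class q (x a)) (class q (x b))
        ⇐ (inj₁ e)              = inj₁ (from (lab _ _) e)
        ⇐ (inj₂ (inj₁ (e , f))) = inj₂ (inj₁ (from (lab _ _) e , from (lab _ _) f))
        ⇐ (inj₂ (inj₂ (e , f))) = inj₂ (inj₂ (from (lab _ _) e , from (lab _ _) f))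

      coarsen₁ : ∀ {m} (q : Classes _~_ m) e ls → LabelledBy q ls → x (proj₁ e) ~ x (proj₂ e) →
        Coarsening q (e ∷ []) ls
      coarsen₁ {m} q (i , j) ls lab xi~xj with lookup ls i ≟ lookup ls j in eq
      ... | yes li≡lj = record
        { classes = q
        ; size-+  = trans (cong (λ d → m + ((if does d then 0 else 1) + 0)) eq) (+-identityʳ m)
        ; coarser = λ e → e
        -- Contracting an edge whose ends already share a label is treated like a real merge: gluing
        -- two equal classes does not change the kernel.
        ; labels  = contract-labels q q ls i j lab λ a b → mk⇔ inj₁ unglue
        ; joined  = λ { (here refl) → i≡j }
        }
        where
        i≡j : class q (x i) ≡ class q (x j)
        i≡j = from (lab i j) li≡lj
        unglue : ∀ {a b} → Glued (class q (x i)) (class q (x j)) a b → a ≡ b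
        unglue (inj₁ e)              = e
        unglue (inj₂ (inj₁ (e , f))) = trans e (trans i≡j (sym f))
        unglue (inj₂ (inj₂ (e , f))) = trans e (trans (sym i≡j) (sym f))
      ... | no li≢lj with Fin⇒suc (class q (x i))
      ... | k , refl with merge q xi~xj (li≢lj ∘ to (lab i j))
      ... | q′ , kernel = record
        { classes = q′
        ; size-+  = trans (cong (λ d → k + ((if does d then 0 else 1) + 0)) eq) (+-comm k 1)
        ; coarser = from (kernel _ _) ∘ inj₁
        ; labels  = contract-labels q q′ ls i j lab kernel
        ; joined  = λ { (here refl) → from (kernel _ _) (inj₂ (inj₁ (refl , refl))) }
        }

      coarsen : ∀ {m} (q : Classes _~_ m) es ls → LabelledBy q ls →
        All (λ e → x (proj₁ e) ~ x (proj₂ e)) es → Coarsening q es ls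
      coarsen q []       ls lab []       = record
        { classes = q ; size-+ = +-identityʳ _ ; coarser = λ e → e ; labels = lab ; joined = λ () }
      coarsen q (e ∷ es) ls lab (p ∷ ps) = record
        { classes = classes c₂
        ; size-+  = trans (trans (cong (size c₂ +_) (+-comm g (rank es _)))
                      (trans (sym (+-assoc (size c₂) _ g)) (cong (_+ g) (size-+ c₂))))
                      (trans (cong (size c₁ +_) (sym (+-identityʳ g))) (size-+ c₁))
        ; coarser = coarser c₂ ∘ coarser c₁
        ; labels  = labels c₂
        ; joined  = λ { (here refl) → coarser c₂ (joined c₁ (here refl)) ; (there e∈) → joined c₂ e∈ }
        }
        where
        g = gain e ls
        c₁ = coarsen₁ q e ls lab p
        c₂ = coarsen (classes c₁) es (contract e ls) (labels c₁) ps

  -- States of a column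

  Colours : Set
  Colours = Vec (Fin 2) 4

  State : Set
  State = Colours × Vec ℕ 4

  _≟ˢ_ : DecidableEquality State
  _≟ˢ_ = ≡-dec (≡-decⱽ _≟ᶠ_) (≡-decⱽ _≟_)

  open Membership _≟ˢ_ using () renaming (_∈?_ to _∈ˢ?_)

  starEdges : ∀ {n} → List (Edge {4 + n})
  starEdges = (0F , 1F) ∷ (0F , 2F) ∷ (0F , 3F) ∷ []

  -- Contracting (i , j) keeps the label of i.  In this order, and after the star edges,
  -- each class meeting the new column ends up labelled by its least new vertex, so labels
  -- are canonical and only finitely many states occur.
  crossEdges : List (Edge {8})
  crossEdges = (3F , 7F) ∷ (2F , 6F) ∷ (1F , 5F) ∷ (0F , 4F) ∷ []

  Mono : ∀ {N} → Vec (Fin 2) N → Edge {N} → Set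
  Mono cs (i , j) = lookup cs i ≡ lookup cs j

  mono? : ∀ {N} (cs : Vec (Fin 2) N) → Decidable (Mono cs)
  mono? cs (i , j) = lookup cs i ≟ᶠ lookup cs j

  fresh : Vec ℕ 4
  fresh = tabulate toℕ

  initialEdges : Colours → List (Edge {4})
  initialEdges c = filter (mono? c) starEdges

  initialLabels : Colours → Vec ℕ 4
  initialLabels c = contractAll (initialEdges c) fresh

  initial : Colours → State
  initial c = c , initialLabels c

  stepEdges : Colours → Colours → List (Edge {8})
  stepEdges c′ c = filter (mono? (c ++ c′)) (starEdges ++ᴸ crossEdges)

  -- Positions 0 to 3 are the new column, 4 to 7 the old one. Adding 4 separates the old labels from
  -- the fresh ones. The old column is dropped afterwards because no later edge meets it.
  stepLabels : State → Colours → Vec ℕ 4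
  stepLabels (c′ , ls) c = take 4 (contractAll (stepEdges c′ c) (fresh ++ map (4 +_) ls))

  step : State → Colours → State
  step s c = c , stepLabels s c

  initialRank : Colours → ℕ
  initialRank c = rank (initialEdges c) fresh

  stepRank : State → Colours → ℕ
  stepRank (c′ , ls) c = rank (stepEdges c′ c) (fresh ++ map (4 +_) ls)

  colours : Fin 16 → Colours
  colours i = tabulate (finToFun i)

  -- Position 0 is the centre. Its label is discarded, since its class is determined by the colours.
  leafClasses : State → ℕ
  leafClasses (_ , _ ∷ ls) = length (deduplicate _≟_ (toList ls))

  one two : State → ℕ
  one s = if leafClasses s ≡ᵇ 1 then 1 else 0
  two s = if leafClasses s ≡ᵇ 2 then 1 else 0

  totalRank : State → ℕ
  totalRank s = sum λ i → stepRank s (colours i)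

  -- Every reachable state is already reached after two columns.
  states : List State
  states = deduplicate _≟ˢ_ (mapᴸ
    (λ (i , j) → step (initial (colours i)) (colours j))
    (cartesianProduct (allFin 16) (allFin 16)))

  -- The transfer operator on functions of the state, dual to the matrix that counts colourings by
  -- state.
  transfer : (State → ℕ) → State → ℕ
  transfer φ s = sum λ i → φ (step s (colours i))

  initial-reachable : ∀ i → initial (colours i) ∈ states
  initial-reachable = from-yes (allᶠ? λ i → initial (colours i) ∈ˢ? states)

  step-reachable : ∀ {s} → s ∈ states → ∀ i → step s (colours i) ∈ states
  step-reachable = All.lookup
    (from-yes (All.all? (λ s → allᶠ? λ i → step s (colours i) ∈ˢ? states) states))

  agree-on-states : (f g : State → ℕ) {_ : True (All.all? (λ s → f s ≟ g s) states)} →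
    ∀ {s} → s ∈ states → f s ≡ g s
  agree-on-states f g {p} = All.lookup (toWitness p)

  -- The functions one, two and the constants span a space invariant under transfer which
  -- also contains transfer totalRank (but not totalRank): the eigenvalues 16, 2 and 1 on
  -- it give the terms n and 1, 2⁻³ⁿ and 2⁻⁴ⁿ of the formula.
  transfer-one : ∀ {s} → s ∈ states → transfer one s ≡ one s + 2
  transfer-one = agree-on-states (transfer one) (λ s → one s + 2)

  -- A lone column has two leaf classes in 6 cases (exactly two leaves agree with the centre). A
  -- joined pair of colour b adds the 2 columns in which both its leaves have colour b and the
  -- centre does not; a joined triple adds the 3 columns with the other centre colour and exactly
  -- two leaves of colour b.
  transfer-two : ∀ {s} → s ∈ states → transfer two s ≡ 3 * one s + 2 * two s + 6
  transfer-two = agree-on-states (transfer two) (λ s → 3 * one s + 2 * two s + 6)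

  -- For three leaf classes the value is that of a lone column, `ranks 0`, which is 800. A joined
  -- pair of colour b costs 4: in 2 next columns it stays joined without help of the centre, and
  -- each of these has 2 successors (pair and centre of colour b) where a cross edge closes an
  -- additional cycle. A joined triple costs 3 * 2 + 5: three next columns keep exactly two of its
  -- leaves, and one keeps all three, losing 3 * 1 + 2 in the column after it.
  transfer-totalRank : ∀ {s} → s ∈ states → transfer totalRank s + (11 * one s + 4 * two s) ≡ 800
  transfer-totalRank = agree-on-states (λ s → transfer totalRank s + (11 * one s + 4 * two s)) (λ _ → 800)

  -- The grid, column by column

  Leg : Set
  Leg = Fin 1 ⊎ Fin 3

  grid : ℕ → Graph
  grid n = K 1 3 □ P n

  leg : Fin 4 → Leg
  leg = splitAt 1

  index : Leg → Fin 4
  index = join 1 3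

  column : ∀ {n} → Colouring 2 (grid (suc n)) → Colours
  column d = tabulate λ j → d (leg j , zero)

  rest : ∀ {n} → Colouring 2 (grid (suc n)) → Colouring 2 (grid n)
  rest d (k , i) = d (k , suc i)

  -- Column zero is the one added last: `rest` removes it, so the recursion builds the grid from the
  -- far end of the path.
  labelling : ∀ n → Colouring 2 (grid (suc n)) → Vec ℕ 4
  labelling zero    d = initialLabels (column d)
  labelling (suc n) d = stepLabels (column (rest d) , labelling n (rest d)) (column d)

  state : ∀ n → Colouring 2 (grid (suc n)) → State
  state n d = column d , labelling n d

  gridRank : ∀ n → Colouring 2 (grid (suc n)) → ℕ
  gridRank zero    d = initialRank (column d)
  gridRank (suc n) d = stepRank (state n (rest d)) (column d) + gridRank n (rest d)

  module _ {n : ℕ} (d : Colouring 2 (grid n)) where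
    open Graph (monochromatic (grid n) d) public using ()
      renaming (Adj to Adj[_]; Connected to Connected[_]; adj-sym to adj-sym[_])

  connected-sym : ∀ {n} (d : Colouring 2 (grid n)) {u v} → Connected[ d ] u v → Connected[ d ] v u
  connected-sym d = Star.reverse λ {u} {v} → adj-sym[ d ] {u} {v}

  index-leg : ∀ j → index (leg j) ≡ j
  index-leg = join-splitAt 1 3

  leg-index : ∀ k → leg (index k) ≡ k
  leg-index = splitAt-join 1 3

  index-injective : ∀ {k l} → index k ≡ index l → k ≡ l
  index-injective {k} {l} e = trans (sym (leg-index k)) (trans (cong leg e) (leg-index l))

  record GridClasses (n : ℕ) (d : Colouring 2 (grid (suc n))) : Set where
    field
      {size}  : ℕ
      classes : Classes (Connected[ d ]) size
      size-+  : size + gridRank n d ≡ suc n * 4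
      resp    : ∀ {u v} → Adj[ d ] u v → class classes u ≡ class classes v
      labels  : LabelledBy (connected-sym d) _◅◅_ (λ j → leg j , zero) classes (labelling n d)

  lookup-fresh : ∀ {i j} → i ≡ j ⇔ lookup fresh i ≡ lookup fresh j
  lookup-fresh {i} {j} = mk⇔ (cong (lookup fresh)) λ e →
    toℕ-injective (trans (sym (lookup∘tabulate toℕ i)) (trans e (lookup∘tabulate toℕ j)))

  star-adjacent : ∀ {n} (d : Colouring 2 (grid (suc n))) → ∀ j →
    d (leg zero , zero) ≡ d (leg (suc j) , zero) → Adj[ d ] (leg zero , zero) (leg (suc j) , zero)
  star-adjacent d j e = inj₂ (refl , tt) , e

  star-∈ : ∀ {n} j → (zero , (suc j) ↑ˡ n) ∈ starEdges {n}
  star-∈ 0F = here refl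
  star-∈ 1F = there (here refl)
  star-∈ 2F = there (there (here refl))

  initialClasses : (d : Colouring 2 (grid 1)) → Classes (Connected[ d ]) 4
  initialClasses d = record
    { class     = index ∘ proj₁
    ; rep       = λ j → leg j , zero
    ; class-rep = index-leg
    ; class⇒~   = λ { {_ , 0F} {_ , 0F} e → Star.reflexive (Adj[ d ]) (cong (_, 0F) (index-injective e)) }
    }

  module _ (d : Colouring 2 (grid 1)) where
    private
      x : Fin 4 → Leg × Fin 1
      x j = leg j , zero

      edge-adjacent : ∀ {e} → e ∈ starEdges → Mono (column d) e → Adj[ d ] (x (proj₁ e)) (x (proj₂ e))
      edge-adjacent (here refl)                 = star-adjacent d 0F
      edge-adjacent (there (here refl))         = star-adjacent d 1F
      edge-adjacent (there (there (here refl))) = star-adjacent d 2F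

      initial-labels : LabelledBy (connected-sym d) _◅◅_ x (initialClasses d) fresh
      initial-labels i j = subst₂ (λ a b → a ≡ b ⇔ lookup fresh i ≡ lookup fresh j)
        (sym (index-leg i)) (sym (index-leg j)) lookup-fresh

      coarsening : Coarsening (connected-sym d) _◅◅_ x (initialClasses d) (initialEdges (column d)) fresh
      coarsening = coarsen (connected-sym d) _◅◅_ x (initialClasses d) (initialEdges (column d)) fresh
        initial-labels
        (All.tabulate λ e∈ → let e∈ , mono = ∈-filter⁻ (mono? (column d)) e∈ in
          edge-adjacent e∈ mono ◅ ε)

      open Coarsening coarsening

      star-joined : ∀ j → d (x 0F) ≡ d (x (suc j)) → class classes (x 0F) ≡ class classes (x (suc j))
      star-joined 0F e = joined (∈-filter⁺ (mono? (column d)) (star-∈ 0F) e)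
      star-joined 1F e = joined (∈-filter⁺ (mono? (column d)) (star-∈ 1F) e)
      star-joined 2F e = joined (∈-filter⁺ (mono? (column d)) (star-∈ 2F) e)

      respects : ∀ {u v} → Adj[ d ] u v → class classes u ≡ class classes v
      respects {_ , 0F}       {_ , 0F}       (inj₁ (_ , inj₁ ()) , _)
      respects {_ , 0F}       {_ , 0F}       (inj₁ (_ , inj₂ ()) , _)
      respects {inj₁ 0F , 0F} {inj₂ j , 0F}  (inj₂ _ , e) = star-joined j e
      respects {inj₂ j , 0F}  {inj₁ 0F , 0F} (inj₂ _ , e) = sym (star-joined j (sym e))

    gridClasses-base : GridClasses 0 d
    gridClasses-base = record { classes = classes ; size-+ = size-+ ; resp = respects ; labels = labels }

  lookup-take : ∀ {A : Set} m {n} (xs : Vec A (m + n)) (i : Fin m) → lookup (take m xs) i ≡ lookup xs (i ↑ˡ n)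
  lookup-take (suc m) (x ∷ xs) zero    = refl
  lookup-take (suc m) (x ∷ xs) (suc i) = lookup-take m xs i

  ↑ˡ≢↑ʳ : ∀ {m n} (i : Fin m) (j : Fin n) → i ↑ˡ n ≢ m ↑ʳ j
  ↑ˡ≢↑ʳ {m} {n} i j e with trans (sym (splitAt-↑ˡ m i n)) (trans (cong (splitAt m) e) (splitAt-↑ʳ m n j))
  ... | ()

  shift : ∀ {n} → Leg × Fin n → Leg × Fin (suc n)
  shift (k , i) = k , suc i

  -- The induction step: one more column.

  module _ {n : ℕ} (d : Colouring 2 (grid (suc (suc n)))) where

    shift-adjacent : ∀ {u v} → Adj[ rest d ] u v → Adj[ d ] (shift u) (shift v)
    shift-adjacent (inj₁ (e , a) , c) = inj₁ (e , map⊎ (cong suc) (cong suc) a) , c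
    shift-adjacent (inj₂ (e , a) , c) = inj₂ (cong suc e , a) , c

    module _ {m : ℕ} (q : Classes (Connected[ rest d ]) m) where

      extendClass : Leg × Fin (suc (suc n)) → Fin (4 + m)
      extendClass (k , zero)  = index k ↑ˡ m
      extendClass (k , suc i) = 4 ↑ʳ class q (k , i)

      -- The starting point before any new edge: four singletons beside the old classes, which
      -- remain connected because the old grid embeds by `shift`.
      extendClasses : Classes (Connected[ d ]) (4 + m)
      extendClasses = record
        { class = extendClass
        ; rep   = rep′ ∘ splitAt 4
        ; class-rep = λ i → trans (class-rep′ (splitAt 4 i)) (join-splitAt 4 m i)
        ; class⇒~ = class⇒~′
        }
        where
        rep′ : Fin 4 ⊎ Fin m → Leg × Fin (suc (suc n))
        rep′ = [ (λ j → leg j , zero) , shift ∘ rep q ]′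

        class-rep′ : ∀ s → extendClass (rep′ s) ≡ join 4 m s
        class-rep′ (inj₁ j) = cong (_↑ˡ m) (index-leg j)
        class-rep′ (inj₂ i) = cong (4 ↑ʳ_) (class-rep q i)

        class⇒~′ : ∀ {u v} → extendClass u ≡ extendClass v → Connected[ d ] u v
        class⇒~′ {k , zero}  {l , zero}  e =
          Star.reflexive (Adj[ d ]) (cong (_, zero) (index-injective (↑ˡ-injective m _ _ e)))
        class⇒~′ {k , zero}  {l , suc j} e = contradiction e (↑ˡ≢↑ʳ _ _)
        class⇒~′ {k , suc i} {l , zero}  e = contradiction (sym e) (↑ˡ≢↑ʳ _ _)
        class⇒~′ {k , suc i} {l , suc j} e =
          Star.gmap shift shift-adjacent (class⇒~ q (↑ʳ-injective 4 _ _ e))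

    private
      place : Fin 4 ⊎ Fin 4 → Leg × Fin (suc (suc n))
      place = [ (λ j → leg j , 0F) , (λ j → leg j , 1F) ]′

      x : Fin 8 → Leg × Fin (suc (suc n))
      x = place ∘ splitAt 4

      c c′ : Colours
      c  = column d
      c′ = column (rest d)

      cross-adjacent : ∀ k → d (k , 0F) ≡ d (k , 1F) → Adj[ d ] (k , 0F) (k , 1F)
      cross-adjacent k e = inj₁ (refl , inj₁ refl) , e

      edge-adjacent : ∀ {e} → e ∈ starEdges ++ᴸ crossEdges → Mono (c ++ c′) e → Adj[ d ] (x (proj₁ e)) (x (proj₂ e))
      edge-adjacent (here refl)                                                 = star-adjacent d 0F
      edge-adjacent (there (here refl))                                         = star-adjacent d 1F
      edge-adjacent (there (there (here refl)))                                 = star-adjacent d 2F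
      edge-adjacent (there (there (there (here refl))))                         = cross-adjacent (leg 3F)
      edge-adjacent (there (there (there (there (here refl)))))                 = cross-adjacent (leg 2F)
      edge-adjacent (there (there (there (there (there (here refl))))))         = cross-adjacent (leg 1F)
      edge-adjacent (there (there (there (there (there (there (here refl))))))) = cross-adjacent (leg 0F)

    module _ (g : GridClasses n (rest d)) where
      private
        module g = GridClasses g
        open Equivalence

        q : Classes (Connected[ d ]) (4 + g.size)
        q = extendClasses g.classes

        old : Vec ℕ 4
        old = labelling n (rest d)

        ls : Vec ℕ 8
        ls = fresh ++ map (4 +_) old

        label : Fin 4 ⊎ Fin 4 → ℕ
        label = [ lookup fresh , lookup (map (4 +_) old) ]′

        fresh≢old : ∀ i j → lookup fresh i ≢ lookup (map (4 +_) old) j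
        fresh≢old i j e = <⇒≢ (≤-trans (toℕ<n i) (m≤m+n 4 (lookup old j)))
          (trans (sym (lookup∘tabulate toℕ i)) (trans e (lookup-map j (4 +_) old)))

        extend-labels′ : ∀ s t → class q (place s) ≡ class q (place t) ⇔ label s ≡ label t
        extend-labels′ (inj₁ i) (inj₁ j) = subst₂ (λ a b → a ↑ˡ g.size ≡ b ↑ˡ g.size ⇔ label (inj₁ i) ≡ label (inj₁ j))
          (sym (index-leg i)) (sym (index-leg j))
          (mk⇔ (to lookup-fresh ∘ ↑ˡ-injective g.size i j) (cong (_↑ˡ g.size) ∘ from lookup-fresh))
        extend-labels′ (inj₁ i) (inj₂ j) = mk⇔ (λ e → contradiction e (↑ˡ≢↑ʳ (index (leg i)) _))
          (λ e → contradiction e (fresh≢old i j))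
        extend-labels′ (inj₂ i) (inj₁ j) = mk⇔ (λ e → contradiction (sym e) (↑ˡ≢↑ʳ (index (leg j)) _))
          (λ e → contradiction (sym e) (fresh≢old j i))
        extend-labels′ (inj₂ i) (inj₂ j) = subst₂ (λ a b → class q (place (inj₂ i)) ≡ class q (place (inj₂ j)) ⇔ a ≡ b)
          (sym (lookup-map i (4 +_) old)) (sym (lookup-map j (4 +_) old))
          (mk⇔ (cong (4 +_) ∘ to (g.labels i j) ∘ ↑ʳ-injective 4 _ _)
               (cong (4 ↑ʳ_) ∘ from (g.labels i j) ∘ +-cancelˡ-≡ 4 _ _))

        extend-labels : LabelledBy (connected-sym d) _◅◅_ x q ls
        extend-labels i j = subst₂ (λ a b → class q (x i) ≡ class q (x j) ⇔ a ≡ b)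
          (sym (lookup-splitAt 4 fresh _ i)) (sym (lookup-splitAt 4 fresh _ j))
          (extend-labels′ (splitAt 4 i) (splitAt 4 j))

        coarsening : Coarsening (connected-sym d) _◅◅_ x q (stepEdges c′ c) ls
        coarsening = coarsen (connected-sym d) _◅◅_ x q (stepEdges c′ c) ls extend-labels
          (All.tabulate λ e∈ → let e∈ , mono = ∈-filter⁻ (mono? (c ++ c′)) e∈ in edge-adjacent e∈ mono ◅ ε)

        open Coarsening coarsening

        joined-edge : ∀ {i j} → (i , j) ∈ starEdges ++ᴸ crossEdges → lookup (c ++ c′) i ≡ lookup (c ++ c′) j →
          class classes (x i) ≡ class classes (x j)
        joined-edge e∈ mono = joined (∈-filter⁺ (mono? (c ++ c′)) e∈ mono)

        star-joined : ∀ j → d (leg 0F , 0F) ≡ d (leg (suc j) , 0F) →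
          class classes (leg 0F , 0F) ≡ class classes (leg (suc j) , 0F)
        star-joined 0F = joined-edge (∈-++⁺ˡ (star-∈ 0F))
        star-joined 1F = joined-edge (∈-++⁺ˡ (star-∈ 1F))
        star-joined 2F = joined-edge (∈-++⁺ˡ (star-∈ 2F))

        cross-joined : ∀ k → d (k , 0F) ≡ d (k , 1F) → class classes (k , 0F) ≡ class classes (k , 1F)
        cross-joined (inj₁ 0F) = joined-edge (∈-++⁺ʳ starEdges (there (there (there (here refl)))))
        cross-joined (inj₂ 0F) = joined-edge (∈-++⁺ʳ starEdges (there (there (here refl))))
        cross-joined (inj₂ 1F) = joined-edge (∈-++⁺ʳ starEdges (there (here refl)))
        cross-joined (inj₂ 2F) = joined-edge (∈-++⁺ʳ starEdges (here refl))

        old-joined : ∀ u v → Adj[ rest d ] u v → class classes (shift u) ≡ class classes (shift v)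
        old-joined u v a = coarser {shift u} {shift v} (cong (4 ↑ʳ_) (g.resp {u} {v} a))

        respects : ∀ {u v} → Adj[ d ] u v → class classes u ≡ class classes v
        respects {_ , zero}       {_ , zero}        (inj₁ (_ , inj₁ ()) , _)
        respects {_ , zero}       {_ , zero}        (inj₁ (_ , inj₂ ()) , _)
        respects {k , zero}       {_ , suc 0F}      (inj₁ (refl , inj₁ refl) , e) = cross-joined k e
        respects {k , suc 0F}     {_ , zero}        (inj₁ (refl , inj₂ refl) , e) = sym (cross-joined k (sym e))
        respects {_ , suc (suc _)} {_ , zero}       (inj₁ (refl , inj₁ ()) , _)
        respects {_ , suc (suc _)} {_ , zero}       (inj₁ (refl , inj₂ ()) , _)
        respects {k , suc i}      {_ , suc j}       (inj₁ (refl , a) , e) =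
          old-joined (k , i) (k , j) (inj₁ (refl , map⊎ suc-injective suc-injective a) , e)
        respects {inj₁ 0F , zero} {inj₂ j , zero}   (inj₂ _ , e) = star-joined j e
        respects {inj₂ j , zero}  {inj₁ 0F , zero}  (inj₂ _ , e) = sym (star-joined j (sym e))
        respects {k , suc i}      {l , suc .i}      (inj₂ (refl , a) , e) = old-joined (k , i) (l , i) (inj₂ (refl , a) , e)

      gridClasses-step : GridClasses (suc n) d
      gridClasses-step = record
        { classes = classes
        ; size-+  = trans (sym (+-assoc size _ _))
            (trans (cong (_+ gridRank n (rest d)) size-+) (cong (4 +_) g.size-+))
        ; resp    = respects
        ; labels  = λ i j → subst₂ (λ s t → class classes (place s) ≡ class classes (place t) ⇔
              lookup (labelling (suc n) d) i ≡ lookup (labelling (suc n) d) j)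
            (splitAt-↑ˡ 4 i 4) (splitAt-↑ˡ 4 j 4)
            (subst₂ (λ a b → class classes (x (i ↑ˡ 4)) ≡ class classes (x (j ↑ˡ 4)) ⇔ a ≡ b)
              (sym (lookup-take 4 (contractAll (stepEdges c′ c) ls) i))
              (sym (lookup-take 4 (contractAll (stepEdges c′ c) ls) j))
              (labels (i ↑ˡ 4) (j ↑ˡ 4)))
        }

  gridClasses : ∀ n d → GridClasses n d
  gridClasses zero    d = gridClasses-base d
  gridClasses (suc n) d = gridClasses-step d (gridClasses n (rest d))

  #blocks-+-gridRank : ∀ n d → #blocks (grid (suc n)) d + gridRank n d ≡ suc n * 4
  #blocks-+-gridRank n d = trans
    (cong (_+ gridRank n d) (#components≡#classes (monochromatic (grid (suc n)) d) classes λ {u} {v} → resp {u} {v}))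
    size-+
    where open GridClasses (gridClasses n d)

  -- Sums over all colourings

  sum-++ : ∀ m {n} (f : Fin (m + n) → ℕ) → sum f ≡ sum (f ∘ (_↑ˡ n)) + sum (f ∘ (m ↑ʳ_))
  sum-++ zero    f = refl
  sum-++ (suc m) f = trans (cong (f zero +_) (sum-++ m (f ∘ suc))) (sym (+-assoc (f zero) _ _))

  sum-combine : ∀ m {n} (f : Fin (m * n) → ℕ) → sum f ≡ sum λ (i : Fin m) → sum λ (j : Fin n) → f (combine i j)
  sum-combine zero        f = refl
  sum-combine (suc m) {n} f = trans (sum-++ n f) (cong (sum (f ∘ (_↑ˡ m * n)) +_) (sum-combine m (f ∘ (n ↑ʳ_))))

  sum-const : ∀ n k → sum {n} (λ _ → k) ≡ n * k
  sum-const zero    k = refl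
  sum-const (suc n) k = cong (k +_) (sum-const n k)

  funToFin-cong : ∀ {m n} {f g : Fin m → Fin n} → f ≗ g → funToFin f ≡ funToFin g
  funToFin-cong {zero}  f≗g = refl
  funToFin-cong {suc m} f≗g = cong₂ combine (f≗g zero) (funToFin-cong (f≗g ∘ suc))

  module _ (G : Graph) where
    open Graph G using (to; from; strictlyInverseʳ; order)
    open Inverse (Graph.label G) using (strictlyInverseˡ)

    encode : ∀ {k} → Colouring k G → Fin (k ^ order)
    encode d = funToFin (d ∘ from)

    encode-cong : ∀ {k} {d d′ : Colouring k G} → d ≗ d′ → encode d ≡ encode d′
    encode-cong e = funToFin-cong (e ∘ from)

    colouring-encode : ∀ {k} (d : Colouring k G) → colouring k G (encode d) ≗ d
    colouring-encode d v = trans (finToFun-funToFin (d ∘ from) (to v)) (cong d (strictlyInverseʳ v))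

    encode-colouring : ∀ {k} i → encode (colouring k G i) ≡ i
    encode-colouring {k} i = trans
      (funToFin-cong (cong (finToFun i) ∘ strictlyInverseˡ))
      (funToFin-finToFin {order} i)

  total : ∀ n → (Colouring 2 (grid n) → ℕ) → ℕ
  total n F = sum (F ∘ colouring 2 (grid n))

  cons : ∀ {n} → Fin 16 → Colouring 2 (grid n) → Colouring 2 (grid (suc n))
  cons c d (k , zero)  = finToFun c (index k)
  cons c d (k , suc i) = d (k , i)

  module _ (n : ℕ) where
    private
      join-column : Fin (2 ^ (4 * n)) × Fin 16 → Fin (2 ^ (4 * suc n))
      join-column (j , c) = encode (grid (suc n)) (cons c (colouring 2 (grid n) j))

      split-column : Fin (2 ^ (4 * suc n)) → Fin (2 ^ (4 * n)) × Fin 16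
      split-column i = encode (grid n) (rest d) , funToFin λ j → d (leg j , zero)
        where d = colouring 2 (grid (suc n)) i

      join-split : ∀ i → join-column (split-column i) ≡ i
      join-split i = trans (encode-cong (grid (suc n)) same) (encode-colouring (grid (suc n)) i)
        where
        d = colouring 2 (grid (suc n)) i
        same : cons (proj₂ (split-column i)) (colouring 2 (grid n) (proj₁ (split-column i))) ≗ d
        same (k , zero)  = trans (finToFun-funToFin (λ j → d (leg j , zero)) (index k))
                                 (cong (λ l → d (l , zero)) (leg-index k))
        same (k , suc i) = colouring-encode (grid n) (rest d) (k , i)

      split-join : ∀ p → split-column (join-column p) ≡ p
      split-join (j , c) = cong₂ _,_
        (trans (encode-cong (grid n) λ (k , i) → colouring-encode (grid (suc n)) d (k , suc i))
               (encode-colouring (grid n) j))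
        (trans (funToFin-cong λ j → trans (colouring-encode (grid (suc n)) d (leg j , zero))
                                     (cong (finToFun c) (index-leg j)))
               (funToFin-finToFin {4} c))
        where d = cons c (colouring 2 (grid n) j)

      -- The label of a grid vertex has the path index as its lower digit, so the four entries of a
      -- column are scattered through the code of a colouring. Splitting off a column therefore
      -- permutes the codes.
      columns : Permutation (2 ^ (4 * n) * 16) (2 ^ (4 * suc n))
      columns = mk↔ₛ′ (join-column ∘ remQuot 16) (uncurry combine ∘ split-column)
        (λ i → trans (cong join-column (remQuot-combine (proj₁ (split-column i)) (proj₂ (split-column i)))) (join-split i))
        (λ p → trans (cong (uncurry combine) (split-join (remQuot 16 p))) (combine-remQuot {2 ^ (4 * n)} 16 p))

    -- `F` has to respect pointwise equality because decoding an encoded colouring returns it only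
    -- up to `≗`.
    total-suc : ∀ {F} → (∀ {d d′} → d ≗ d′ → F d ≡ F d′) →
      total (suc n) F ≡ total n λ d → sum λ c → F (cons c d)
    total-suc {F} F-cong = begin
      total (suc n) F                                     ≡⟨ sum-permute (F ∘ colouring 2 (grid (suc n))) columns ⟩
      sum (F ∘ colouring 2 (grid (suc n)) ∘ join-column ∘ remQuot 16)
        ≡⟨ sum-cong-≗ (λ p → F-cong (colouring-encode (grid (suc n)) (cons-at (remQuot 16 p)))) ⟩
      sum (F ∘ cons-at ∘ remQuot 16)                      ≡⟨ sum-combine (2 ^ (4 * n)) (F ∘ cons-at ∘ remQuot 16) ⟩
      sum (λ (j : Fin (2 ^ (4 * n))) → sum λ (c : Fin 16) → F (cons-at (remQuot 16 (combine j c))))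
        ≡⟨ sum-cong-≗ (λ j → sum-cong-≗ λ c → cong (F ∘ cons-at) (remQuot-combine j c)) ⟩
      total n (λ d → sum λ c → F (cons c d))              ∎
      where
      cons-at : Fin (2 ^ (4 * n)) × Fin 16 → Colouring 2 (grid (suc n))
      cons-at (j , c) = cons c (colouring 2 (grid n) j)

  module _ {n : ℕ} where

    total-cong : {F F′ : Colouring 2 (grid n) → ℕ} → (∀ d → F d ≡ F′ d) → total n F ≡ total n F′
    total-cong e = sum-cong-≗ (e ∘ colouring 2 (grid n))

    total-+ : ∀ F F′ → total n (λ d → F d + F′ d) ≡ total n F + total n F′
    total-+ F F′ = ∑-distrib-+ (F ∘ colouring 2 (grid n)) (F′ ∘ colouring 2 (grid n))

    total-* : ∀ k F → total n (λ d → k * F d) ≡ k * total n F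
    total-* k F = sym (*-distribˡ-sum k (F ∘ colouring 2 (grid n)))

    total-const : ∀ k → total n (λ _ → k) ≡ 2 ^ (4 * n) * k
    total-const = sum-const (2 ^ (4 * n))

  column-cong : ∀ {n} {d d′ : Colouring 2 (grid (suc n))} → d ≗ d′ → column d ≡ column d′
  column-cong e = tabulate-cong λ j → e (leg j , zero)

  state-cong : ∀ n {d d′} → d ≗ d′ → state n d ≡ state n d′
  state-cong zero    e = cong initial (column-cong e)
  state-cong (suc n) e = cong₂ step (state-cong n λ (k , i) → e (k , suc i)) (column-cong e)

  gridRank-cong : ∀ n {d d′} → d ≗ d′ → gridRank n d ≡ gridRank n d′
  gridRank-cong zero    e = cong initialRank (column-cong e)
  gridRank-cong (suc n) e = cong₂ _+_
    (cong₂ stepRank (state-cong n λ (k , i) → e (k , suc i)) (column-cong e))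
    (gridRank-cong n λ (k , i) → e (k , suc i))

  colours-surjective : ∀ c → colours (funToFin (lookup c)) ≡ c
  colours-surjective c = trans (tabulate-cong (finToFun-funToFin (lookup c))) (tabulate∘lookup c)

  state-reachable : ∀ n d → state n d ∈ states
  state-reachable zero    d = subst (λ c → initial c ∈ states) (colours-surjective (column d))
    (initial-reachable (funToFin (lookup (column d))))
  state-reachable (suc n) d = subst (λ c → step (state n (rest d)) c ∈ states) (colours-surjective (column d))
    (step-reachable (state-reachable n (rest d)) (funToFin (lookup (column d))))

  -- Recurrences for the totals.

  stateTotal : ℕ → (State → ℕ) → ℕ
  stateTotal n φ = total (suc n) (φ ∘ state n)

  stateTotal-suc : ∀ n φ → stateTotal (suc n) φ ≡ stateTotal n (transfer φ)
  stateTotal-suc n φ = total-suc (suc n) {φ ∘ state (suc n)} (cong φ ∘ state-cong (suc n))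

  -- Index n refers to the graph with suc n columns.
  ones twos ranks rankTotal : ℕ → ℕ
  ones  n = stateTotal n one
  twos  n = stateTotal n two
  ranks n = stateTotal n totalRank
  rankTotal n = total (suc n) (gridRank n)

  #colourings : ℕ → ℕ
  #colourings n = 2 ^ (4 * suc n)

  module _ (n : ℕ) where

    stateTotal-cong : ∀ φ ψ → (∀ {s} → s ∈ states → φ s ≡ ψ s) → stateTotal n φ ≡ stateTotal n ψ
    stateTotal-cong φ ψ e = total-cong λ d → e (state-reachable n d)

    stateTotal-+ : ∀ φ ψ → stateTotal n (λ s → φ s + ψ s) ≡ stateTotal n φ + stateTotal n ψ
    stateTotal-+ φ ψ = total-+ (φ ∘ state n) (ψ ∘ state n)

    stateTotal-* : ∀ k φ → stateTotal n (λ s → k * φ s) ≡ k * stateTotal n φ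
    stateTotal-* k φ = total-* k (φ ∘ state n)

    stateTotal-const : ∀ k → stateTotal n (λ _ → k) ≡ #colourings n * k
    stateTotal-const k = total-const {suc n} k

    stateTotal-comb : ∀ k φ l ψ →
      stateTotal n (λ s → k * φ s + l * ψ s) ≡ k * stateTotal n φ + l * stateTotal n ψ
    stateTotal-comb k φ l ψ = trans (stateTotal-+ (λ s → k * φ s) (λ s → l * ψ s))
      (cong₂ _+_ (stateTotal-* k φ) (stateTotal-* l ψ))

    stateTotal-shift : ∀ φ ψ k → (∀ {s} → s ∈ states → φ s ≡ ψ s + k) →
      stateTotal n φ ≡ stateTotal n ψ + #colourings n * k
    stateTotal-shift φ ψ k e = trans (stateTotal-cong φ (λ s → ψ s + k) e)
      (trans (stateTotal-+ ψ (λ _ → k)) (cong (stateTotal n ψ +_) (stateTotal-const k)))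

    stateTotal-complement : ∀ φ ψ k → (∀ {s} → s ∈ states → φ s + ψ s ≡ k) →
      stateTotal n φ + stateTotal n ψ ≡ #colourings n * k
    stateTotal-complement φ ψ k e = trans (sym (stateTotal-+ φ ψ))
      (trans (stateTotal-cong (λ s → φ s + ψ s) (λ _ → k) e) (stateTotal-const k))

    ones-suc : ones (suc n) ≡ ones n + #colourings n * 2
    ones-suc = trans (stateTotal-suc n one) (stateTotal-shift (transfer one) one 2 transfer-one)

    twos-suc : twos (suc n) ≡ 3 * ones n + 2 * twos n + #colourings n * 6
    twos-suc = trans (stateTotal-suc n two)
      (trans (stateTotal-shift (transfer two) (λ s → 3 * one s + 2 * two s) 6 transfer-two)
        (cong (_+ #colourings n * 6) (stateTotal-comb 3 one 2 two)))

    ranks-suc : ranks (suc n) + (11 * ones n + 4 * twos n) ≡ #colourings n * 800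
    ranks-suc = trans (cong₂ _+_ (stateTotal-suc n totalRank) (sym (stateTotal-comb 11 one 4 two)))
      (stateTotal-complement (transfer totalRank) (λ s → 11 * one s + 4 * two s) 800 transfer-totalRank)

  rankTotal-suc : ∀ n → rankTotal (suc n) ≡ ranks n + 16 * rankTotal n
  rankTotal-suc n = begin
    rankTotal (suc n) ≡⟨ total-suc (suc n) {gridRank (suc n)} (gridRank-cong (suc n)) ⟩
    total (suc n) (λ d → sum λ c → stepRank (state n d) (colours c) + gridRank n d)
      ≡⟨ total-cong (λ d → trans (∑-distrib-+ (stepRank (state n d) ∘ colours) (λ _ → gridRank n d))
           (cong (totalRank (state n d) +_) (sum-const 16 (gridRank n d)))) ⟩
    total (suc n) (λ d → totalRank (state n d) + 16 * gridRank n d)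
      ≡⟨ trans (total-+ (totalRank ∘ state n) (λ d → 16 * gridRank n d)) (cong (ranks n +_) (total-* 16 (gridRank n))) ⟩
    ranks n + 16 * rankTotal n ∎

  blockTotal-+-rankTotal : ∀ n → total (suc n) (#blocks (grid (suc n))) + rankTotal n ≡ #colourings n * (suc n * 4)
  blockTotal-+-rankTotal n = trans (sym (total-+ (#blocks (grid (suc n))) (gridRank n)))
    (trans (total-cong (#blocks-+-gridRank n)) (total-const {suc n} (suc n * 4)))

  -- Solving the recurrences

  ones-step : ∀ {a x} → 15 * a + 2 ≡ 2 * x → 15 * (a + x * 2) + 2 ≡ 2 * (16 * x)
  ones-step {a} {x} h = begin
    15 * (a + x * 2) + 2   ≡⟨ lemma₁ a x ⟩
    (15 * a + 2) + 30 * x  ≡⟨ cong (_+ 30 * x) h ⟩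
    2 * x + 30 * x         ≡⟨ lemma₂ x ⟩
    2 * (16 * x)           ∎
    where
    lemma₁ : ∀ a x → 15 * (a + x * 2) + 2 ≡ (15 * a + 2) + 30 * x
    lemma₁ = solve-∀
    lemma₂ : ∀ x → 2 * x + 30 * x ≡ 2 * (16 * x)
    lemma₂ = solve-∀

  twos-step : ∀ {a b x y} → 15 * a + 2 ≡ 2 * x → 35 * b + 30 * y ≡ 16 * x + 14 →
    35 * (3 * a + 2 * b + x * 6) + 30 * (2 * y) ≡ 16 * (16 * x) + 14
  -- The weights 7 = 35 * 3 / 15 and 2 eliminate `a` and `b`; 14 = 7 * 2 is the offset brought in by
  -- `h₁`.
  twos-step {a} {b} {x} {y} h₁ h₂ = +-cancelʳ-≡ 14 _ _ (begin
    35 * (3 * a + 2 * b + x * 6) + 30 * (2 * y) + 14        ≡⟨ lemma₁ a b x y ⟩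
    7 * (15 * a + 2) + 2 * (35 * b + 30 * y) + 210 * x      ≡⟨ cong₂ (λ s t → 7 * s + 2 * t + 210 * x) h₁ h₂ ⟩
    7 * (2 * x) + 2 * (16 * x + 14) + 210 * x               ≡⟨ lemma₂ x ⟩
    16 * (16 * x) + 14 + 14                                 ∎)
    where
    lemma₁ : ∀ a b x y → 35 * (3 * a + 2 * b + x * 6) + 30 * (2 * y) + 14 ≡
      7 * (15 * a + 2) + 2 * (35 * b + 30 * y) + 210 * x
    lemma₁ = solve-∀
    lemma₂ : ∀ x → 7 * (2 * x) + 2 * (16 * x + 14) + 210 * x ≡ 16 * (16 * x) + 14 + 14
    lemma₂ = solve-∀

  ranks-step₁ : ∀ {a b w x y t} → w + (11 * a + 4 * b) ≡ x * t →
    15 * a + 2 ≡ 2 * x → 35 * b + 30 * y ≡ 16 * x + 14 →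
    105 * w + 346 * x + 14 ≡ 105 * (x * t) + 360 * y
  -- With 105 = lcm(15, 35), the weights are 77 = 105 * 11 / 15 and 12 = 105 * 4 / 35, and 154 = 77
  -- * 2.
  ranks-step₁ {a} {b} {w} {x} {y} {t} h h₁ h₂ = +-cancelʳ-≡ 154 _ _ (begin
    105 * w + 346 * x + 14 + 154                            ≡⟨ lemma₁ w x ⟩
    105 * w + 77 * (2 * x) + 12 * (16 * x + 14)             ≡⟨ cong₂ (λ s t → 105 * w + 77 * s + 12 * t) (sym h₁) (sym h₂) ⟩
    105 * w + 77 * (15 * a + 2) + 12 * (35 * b + 30 * y)    ≡⟨ lemma₂ a b w y ⟩
    105 * (w + (11 * a + 4 * b)) + 360 * y + 154            ≡⟨ cong (λ s → 105 * s + 360 * y + 154) h ⟩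
    105 * (x * t) + 360 * y + 154                           ∎)
    where
    lemma₁ : ∀ w x → 105 * w + 346 * x + 14 + 154 ≡ 105 * w + 77 * (2 * x) + 12 * (16 * x + 14)
    lemma₁ = solve-∀
    lemma₂ : ∀ a b w y → 105 * w + 77 * (15 * a + 2) + 12 * (35 * b + 30 * y) ≡
      105 * (w + (11 * a + 4 * b)) + 360 * y + 154
    lemma₂ = solve-∀

  ranks-step₂ : ∀ {β γ δ e t w x y} → 15 * δ ≡ 14 * e → 16 * γ * 16 + 346 * e ≡ 105 * e * t → 14 * β * 2 ≡ 360 * e →
    105 * w + 346 * x + 14 ≡ 105 * (x * t) + 360 * y →
    105 * e * w + 15 * δ ≡ 16 * γ * (16 * x) + 14 * β * (2 * y)
  ranks-step₂ {β} {γ} {δ} {e} {t} {w} {x} {y} hδ hγ hβ h = +-cancelʳ-≡ (346 * e * x) _ _ (begin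
    105 * e * w + 15 * δ + 346 * e * x               ≡⟨ cong (λ s → 105 * e * w + s + 346 * e * x) hδ ⟩
    105 * e * w + 14 * e + 346 * e * x               ≡⟨ lemma₁ e w x ⟩
    e * (105 * w + 346 * x + 14)                     ≡⟨ cong (e *_) h ⟩
    e * (105 * (x * t) + 360 * y)                    ≡⟨ lemma₂ e t x y ⟩
    105 * e * t * x + 360 * e * y                    ≡⟨ cong₂ (λ r s → r * x + s * y) (sym hγ) (sym hβ) ⟩
    (16 * γ * 16 + 346 * e) * x + 14 * β * 2 * y     ≡⟨ lemma₃ β γ e x y ⟩
    16 * γ * (16 * x) + 14 * β * (2 * y) + 346 * e * x ∎)
    where
    lemma₁ : ∀ e w x → 105 * e * w + 14 * e + 346 * e * x ≡ e * (105 * w + 346 * x + 14)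
    lemma₁ = solve-∀
    lemma₂ : ∀ e t x y → e * (105 * (x * t) + 360 * y) ≡ 105 * e * t * x + 360 * e * y
    lemma₂ = solve-∀
    lemma₃ : ∀ β γ e x y → (16 * γ * 16 + 346 * e) * x + 14 * β * 2 * y ≡
      16 * γ * (16 * x) + 14 * β * (2 * y) + 346 * e * x
    lemma₃ = solve-∀

  -- Under r ↦ w + 16 * r, the parts of the solution with eigenvalues 1 and 2 require 16 - 1 = 15
  -- and 16 - 2 = 14 times themselves in the source `w`. A source with eigenvalue 16 is resonant and
  -- produces the factor `n`. The term with `α` is homogeneous, so only the initial value fixes it.
  rank-step : ∀ {D α β γ δ r w x y n} → D * r + α * x + β * y ≡ γ * (n * x) + δ →
    D * w + 15 * δ ≡ 16 * γ * x + 14 * β * y →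
    D * (w + 16 * r) + α * (16 * x) + β * (2 * y) ≡ γ * (suc n * (16 * x)) + δ
  rank-step {D} {α} {β} {γ} {δ} {r} {w} {x} {y} {n} h₁ h₂ = +-cancelʳ-≡ (15 * δ + 14 * β * y) _ _ (begin
    D * (w + 16 * r) + α * (16 * x) + β * (2 * y) + (15 * δ + 14 * β * y)  ≡⟨ lemma₁ D α β δ r w x y ⟩
    16 * (D * r + α * x + β * y) + (D * w + 15 * δ)                        ≡⟨ cong₂ (λ s t → 16 * s + t) h₁ h₂ ⟩
    16 * (γ * (n * x) + δ) + (16 * γ * x + 14 * β * y)                     ≡⟨ lemma₂ β γ δ x y n ⟩
    γ * (suc n * (16 * x)) + δ + (15 * δ + 14 * β * y)                     ∎)
    where
    lemma₁ : ∀ D α β δ r w x y → D * (w + 16 * r) + α * (16 * x) + β * (2 * y) + (15 * δ + 14 * β * y) ≡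
      16 * (D * r + α * x + β * y) + (D * w + 15 * δ)
    lemma₁ = solve-∀
    lemma₂ : ∀ β γ δ x y n → 16 * (γ * (n * x) + δ) + (16 * γ * x + 14 * β * y) ≡
      γ * ((1 + n) * (16 * x)) + δ + (15 * δ + 14 * β * y)
    lemma₂ = solve-∀

  blocks-from-rank : ∀ {D α β γ δ η s r x y n} → s + r ≡ x * (n * 4) → γ + η ≡ D * 4 →
    D * r + α * x + β * y ≡ γ * (n * x) + δ →
    D * s + δ ≡ α * x + β * y + η * (n * x)
  blocks-from-rank {D} {α} {β} {γ} {δ} {η} {s} {r} {x} {y} {n} h hη h₁ = +-cancelʳ-≡ (γ * (n * x)) _ _ (begin
    D * s + δ + γ * (n * x)                        ≡⟨ lemma₁ D γ δ s x n ⟩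
    D * s + (γ * (n * x) + δ)                      ≡⟨ cong (D * s +_) (sym h₁) ⟩
    D * s + (D * r + α * x + β * y)                ≡⟨ lemma₂ D α β s r x y ⟩
    D * (s + r) + (α * x + β * y)                  ≡⟨ cong (λ t → D * t + (α * x + β * y)) h ⟩
    D * (x * (n * 4)) + (α * x + β * y)            ≡⟨ lemma₃ D α β x y n ⟩
    D * 4 * (n * x) + (α * x + β * y)              ≡⟨ cong (λ t → t * (n * x) + (α * x + β * y)) (sym hη) ⟩
    (γ + η) * (n * x) + (α * x + β * y)            ≡⟨ lemma₄ α β γ η x y n ⟩
    α * x + β * y + η * (n * x) + γ * (n * x)      ∎)
    where
    lemma₁ : ∀ D γ δ s x n → D * s + δ + γ * (n * x) ≡ D * s + (γ * (n * x) + δ)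
    lemma₁ = solve-∀
    lemma₂ : ∀ D α β s r x y → D * s + (D * r + α * x + β * y) ≡ D * (s + r) + (α * x + β * y)
    lemma₂ = solve-∀
    lemma₃ : ∀ D α β x y n → D * (x * (n * 4)) + (α * x + β * y) ≡ D * 4 * (n * x) + (α * x + β * y)
    lemma₃ = solve-∀
    lemma₄ : ∀ α β γ η x y n → (γ + η) * (n * x) + (α * x + β * y) ≡ α * x + β * y + η * (n * x) + γ * (n * x)
    lemma₄ = solve-∀

  #colourings-suc : ∀ n → #colourings (suc n) ≡ 16 * #colourings n
  #colourings-suc n = trans (cong (2 ^_) (*-suc 4 (suc n))) (^-distribˡ-+-* 2 4 (4 * suc n))

  ones-closed : ∀ n → 15 * ones n + 2 ≡ 2 * #colourings n
  ones-closed zero    = refl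
  ones-closed (suc n) = begin
    15 * ones (suc n) + 2                    ≡⟨ cong (λ a → 15 * a + 2) (ones-suc n) ⟩
    15 * (ones n + #colourings n * 2) + 2    ≡⟨ ones-step {ones n} {#colourings n} (ones-closed n) ⟩
    2 * (16 * #colourings n)                 ≡⟨ cong (2 *_) (#colourings-suc n) ⟨
    2 * #colourings (suc n)                  ∎

  twos-closed : ∀ n → 35 * twos n + 30 * 2 ^ suc n ≡ 16 * #colourings n + 14
  twos-closed zero    = refl
  twos-closed (suc n) = begin
    35 * twos (suc n) + 30 * 2 ^ suc (suc n)
      ≡⟨ cong (λ b → 35 * b + 30 * 2 ^ suc (suc n)) (twos-suc n) ⟩
    35 * (3 * ones n + 2 * twos n + #colourings n * 6) + 30 * (2 * 2 ^ suc n)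
      ≡⟨ twos-step {ones n} {twos n} {#colourings n} {2 ^ suc n} (ones-closed n) (twos-closed n) ⟩
    16 * (16 * #colourings n) + 14
      ≡⟨ cong (λ x → 16 * x + 14) (#colourings-suc n) ⟨
    16 * #colourings (suc n) + 14            ∎

  -- The coefficients are variables because normalising c * x for a seven-digit literal c
  -- would unfold it into c summands.
  module ClosedForm {D α β γ δ η e : ℕ}
    (D≡ : D ≡ 105 * e) (δ≡ : 15 * δ ≡ 14 * e)
    (γ≡ : 16 * γ * 16 + 346 * e ≡ 105 * e * 800) (β≡ : 14 * β * 2 ≡ 360 * e) (η≡ : γ + η ≡ D * 4)
    (ranks-base : D * 800 + 15 * δ ≡ 16 * γ * 16 + 14 * β * 2)
    (rankTotal-base : D * 24 + α * 16 + β * 2 ≡ γ * 16 + δ)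
    where

    ranks-closed : ∀ n → D * ranks n + 15 * δ ≡ 16 * γ * #colourings n + 14 * β * 2 ^ suc n
    -- `ranks 0` evaluates to 800 = 256 * (7/2 - 3/8): seven edges, each monochromatic half the
    -- time, less one for each of three squares, monochromatic with probability 1/8.
    ranks-closed zero    = ranks-base
    ranks-closed (suc n) = begin
      D * ranks (suc n) + 15 * δ
        ≡⟨ cong (λ D → D * ranks (suc n) + 15 * δ) D≡ ⟩
      105 * e * ranks (suc n) + 15 * δ
        ≡⟨ ranks-step₂ {β} {γ} {δ} {e} {800} {ranks (suc n)} {#colourings n} {2 ^ suc n} δ≡ γ≡ β≡
             (ranks-step₁ {ones n} {twos n} {ranks (suc n)} {#colourings n} {2 ^ suc n} {800} (ranks-suc n) (ones-closed n) (twos-closed n)) ⟩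
      16 * γ * (16 * #colourings n) + 14 * β * (2 * 2 ^ suc n)
        ≡⟨ cong (λ x → 16 * γ * x + 14 * β * (2 * 2 ^ suc n)) (#colourings-suc n) ⟨
      16 * γ * #colourings (suc n) + 14 * β * 2 ^ suc (suc n)  ∎

    rankTotal-closed : ∀ n →
      D * rankTotal n + α * #colourings n + β * 2 ^ suc n ≡ γ * (suc n * #colourings n) + δ
    -- `rankTotal 0` evaluates to 24 = 16 * 3/2, as a star has no cycles.
    rankTotal-closed zero    = rankTotal-base
    rankTotal-closed (suc n) = begin
      D * rankTotal (suc n) + α * #colourings (suc n) + β * 2 ^ suc (suc n)
        ≡⟨ cong₂ (λ r x → D * r + α * x + β * 2 ^ suc (suc n)) (rankTotal-suc n) (#colourings-suc n) ⟩
      D * (ranks n + 16 * rankTotal n) + α * (16 * #colourings n) + β * (2 * 2 ^ suc n)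
        ≡⟨ rank-step {D} {α} {β} {γ} {δ} {rankTotal n} {ranks n} {#colourings n} {2 ^ suc n} {suc n}
             (rankTotal-closed n) (ranks-closed n) ⟩
      γ * (suc (suc n) * (16 * #colourings n)) + δ
        ≡⟨ cong (λ x → γ * (suc (suc n) * x) + δ) (#colourings-suc n) ⟨
      γ * (suc (suc n) * #colourings (suc n)) + δ  ∎

    blockTotal-closed : ∀ n → D * total (suc n) (#blocks (grid (suc n))) + δ ≡
      α * #colourings n + β * 2 ^ suc n + η * (suc n * #colourings n)
    blockTotal-closed n =
      blocks-from-rank {D} {α} {β} {γ} {δ} {η} {total (suc n) (#blocks (grid (suc n)))} {rankTotal n}
        {#colourings n} {2 ^ suc n} {suc n} (blockTotal-+-rankTotal n) η≡ (rankTotal-closed n)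

-- From totals in ℕ to the mean in ℚ.

open Transfer using (grid; total; #colourings; module ClosedForm)
import Data.Integer as ℤ
import Data.Integer.Properties as ℤ
import Data.Nat as ℕ
import Data.Nat.Properties as ℕ
open import Data.Integer using (+_)
open import Data.Rational using (_/_; _+_; _-_; _*_)
open import Data.Rational using (ℚ; 1ℚ; toℚᵘ)
open import Data.Rational.Properties using (toℚᵘ-injective; toℚᵘ-fromℚᵘ; toℚᵘ-homo-*; toℚᵘ-homo-+; *-identityʳ; *-assoc; *-comm)
open import Data.Rational.Solver using (module +-*-Solver)
import Data.Rational.Unnormalised as ℚᵘ
import Data.Rational.Unnormalised.Properties as ℚᵘ

ι : ℕ → ℚ
ι k = + k / 1

-- `_/_` divides by a gcd, which does not reduce for variable arguments; identities are therefore
-- checked on unnormalised fractions.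
toℚᵘ-ι : ∀ k → toℚᵘ (ι k) ℚᵘ.≃ ℚᵘ.mkℚᵘ (+ k) 0
toℚᵘ-ι k = toℚᵘ-fromℚᵘ (ℚᵘ.mkℚᵘ (+ k) 0)

ι-+ : ∀ a b → ι (a ℕ.+ b) ≡ ι a + ι b
ι-+ a b = toℚᵘ-injective (ℚᵘ.≃-trans (toℚᵘ-ι (a ℕ.+ b)) (ℚᵘ.≃-trans (ℚᵘ.*≡* eq)
  (ℚᵘ.≃-sym (ℚᵘ.≃-trans (toℚᵘ-homo-+ (ι a) (ι b)) (ℚᵘ.+-cong (toℚᵘ-ι a) (toℚᵘ-ι b))))))
  where
  eq : + (a ℕ.+ b) ℤ.* + 1 ≡ (+ a ℤ.* + 1 ℤ.+ + b ℤ.* + 1) ℤ.* + 1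
  eq = cong (ℤ._* + 1) (sym (cong₂ ℤ._+_ (ℤ.*-identityʳ (+ a)) (ℤ.*-identityʳ (+ b))))

ι-* : ∀ a b → ι (a ℕ.* b) ≡ ι a * ι b
ι-* a b = toℚᵘ-injective (ℚᵘ.≃-trans (toℚᵘ-ι (a ℕ.* b)) (ℚᵘ.≃-trans (ℚᵘ.*≡* (cong (ℤ._* + 1) (ℤ.pos-* a b)))
  (ℚᵘ.≃-sym (ℚᵘ.≃-trans (toℚᵘ-homo-* (ι a) (ι b)) (ℚᵘ.*-cong (toℚᵘ-ι a) (toℚᵘ-ι b))))))

/-*-cancel : ∀ k d .{{_ : NonZero d}} → (+ k / d) * ι d ≡ ι k
/-*-cancel k d@(suc d-1) = toℚᵘ-injective (ℚᵘ.≃-trans (toℚᵘ-homo-* (+ k / d) (ι d))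
  (ℚᵘ.≃-trans (ℚᵘ.*-cong (toℚᵘ-fromℚᵘ (ℚᵘ.mkℚᵘ (+ k) d-1)) (toℚᵘ-ι d))
    (ℚᵘ.≃-trans (ℚᵘ.*≡* eq) (ℚᵘ.≃-sym (toℚᵘ-ι k)))))
  where
  eq : + k ℤ.* + d ℤ.* + 1 ≡ + k ℤ.* + (d ℕ.* 1)
  eq = trans (ℤ.*-identityʳ _) (cong (λ m → + k ℤ.* + m) (sym (ℕ.*-identityʳ d)))

*ι-injective : ∀ d .{{_ : NonZero d}} {p q} → p * ι d ≡ q * ι d → p ≡ q
*ι-injective d {p} {q} e = trans (sym (undo p)) (trans (cong (_* (+ 1 / d)) e) (undo q))
  where
  undo : ∀ p → p * ι d * (+ 1 / d) ≡ p
  undo p = begin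
    p * ι d * (+ 1 / d)    ≡⟨ *-assoc p (ι d) (+ 1 / d) ⟩
    p * (ι d * (+ 1 / d))  ≡⟨ cong (p *_) (trans (*-comm (ι d) (+ 1 / d)) (/-*-cancel 1 d)) ⟩
    p * 1ℚ                 ≡⟨ *-identityʳ p ⟩
    p                      ∎

module _ {D α β δ η s x y z n : ℕ} .{{_ : NonZero D}} .{{_ : NonZero x}} .{{_ : NonZero z}} where

  -- Multiplying by the non-zero `x` and `D` clears all denominators; `x ≡ y * z` turns the term in
  -- 1 / z into one in `y`.
  mean-from-total : x ≡ y ℕ.* z → D ℕ.* s ℕ.+ δ ≡ α ℕ.* x ℕ.+ β ℕ.* y ℕ.+ η ℕ.* (n ℕ.* x) →
    + s / x ≡ (+ α / D) + (+ β / D) * (+ 1 / z) - (+ δ / D) * (+ 1 / x) + (+ η / D) * ι n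
  mean-from-total x≡yz h = *ι-injective x (*ι-injective D (trans lhs (sym rhs)))
    where
    open +-*-Solver

    lhs : (+ s / x) * ι x * ι D ≡ ι D * ι s
    lhs = trans (cong (_* ι D) (/-*-cancel s x)) (*-comm (ι s) (ι D))

    z⁻¹x : (+ 1 / z) * ι x ≡ ι y
    z⁻¹x = begin
      (+ 1 / z) * ι x           ≡⟨ cong ((+ 1 / z) *_) (trans (cong ι x≡yz) (ι-* y z)) ⟩
      (+ 1 / z) * (ι y * ι z)   ≡⟨ solve 3 (λ a b c → a :* (b :* c) := b :* (a :* c)) refl (+ 1 / z) (ι y) (ι z) ⟩
      ι y * ((+ 1 / z) * ι z)   ≡⟨ cong (ι y *_) (/-*-cancel 1 z) ⟩
      ι y * 1ℚ                  ≡⟨ *-identityʳ (ι y) ⟩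
      ι y                       ∎

    hℚ : ι D * ι s + ι δ ≡ ι α * ι x + ι β * ι y + ι η * (ι n * ι x)
    hℚ = begin
      ι D * ι s + ι δ       ≡⟨ cong (_+ ι δ) (sym (ι-* D s)) ⟩
      ι (D ℕ.* s) + ι δ     ≡⟨ sym (ι-+ (D ℕ.* s) δ) ⟩
      ι (D ℕ.* s ℕ.+ δ)     ≡⟨ cong ι h ⟩
      ι (α ℕ.* x ℕ.+ β ℕ.* y ℕ.+ η ℕ.* (n ℕ.* x))         ≡⟨ ι-+ (α ℕ.* x ℕ.+ β ℕ.* y) _ ⟩
      ι (α ℕ.* x ℕ.+ β ℕ.* y) + ι (η ℕ.* (n ℕ.* x))       ≡⟨ cong₂ _+_ (ι-+ (α ℕ.* x) _) (trans (ι-* η _) (cong (ι η *_) (ι-* n x))) ⟩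
      ι (α ℕ.* x) + ι (β ℕ.* y) + ι η * (ι n * ι x)       ≡⟨ cong (_+ ι η * (ι n * ι x)) (cong₂ _+_ (ι-* α x) (ι-* β y)) ⟩
      ι α * ι x + ι β * ι y + ι η * (ι n * ι x)           ∎

    expand : ∀ a b c f z′ x′ N X d →
      (a + b * z′ - c * x′ + f * N) * X * d ≡ (a * d) * X + (b * d) * (z′ * X) + (f * d) * (N * X) - (c * d) * (x′ * X)
    expand = solve 9 (λ a b c f z′ x′ N X d →
      (a :+ b :* z′ :- c :* x′ :+ f :* N) :* X :* d :=
      (a :* d) :* X :+ (b :* d) :* (z′ :* X) :+ (f :* d) :* (N :* X) :- (c :* d) :* (x′ :* X)) refl

    rhs : ((+ α / D) + (+ β / D) * (+ 1 / z) - (+ δ / D) * (+ 1 / x) + (+ η / D) * ι n) * ι x * ι D ≡ ι D * ι s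
    rhs = begin
      ((+ α / D) + (+ β / D) * (+ 1 / z) - (+ δ / D) * (+ 1 / x) + (+ η / D) * ι n) * ι x * ι D
        ≡⟨ expand (+ α / D) (+ β / D) (+ δ / D) (+ η / D) (+ 1 / z) (+ 1 / x) (ι n) (ι x) (ι D) ⟩
      (+ α / D) * ι D * ι x + (+ β / D) * ι D * ((+ 1 / z) * ι x) + (+ η / D) * ι D * (ι n * ι x)
        - (+ δ / D) * ι D * ((+ 1 / x) * ι x)
        ≡⟨ cong₂ _-_ (cong₂ _+_ (cong₂ _+_ (cong (_* ι x) (/-*-cancel α D)) (cong₂ _*_ (/-*-cancel β D) z⁻¹x))
                                (cong (_* (ι n * ι x)) (/-*-cancel η D)))
                     (trans (cong₂ _*_ (/-*-cancel δ D) (/-*-cancel 1 x)) (*-identityʳ (ι δ))) ⟩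
      ι α * ι x + ι β * ι y + ι η * (ι n * ι x) - ι δ  ≡⟨ cong (_- ι δ) (sym hℚ) ⟩
      ι D * ι s + ι δ - ι δ                            ≡⟨ solve 2 (λ a b → a :+ b :- b := a) refl (ι D * ι s) (ι δ) ⟩
      ι D * ι s                                        ∎

corollary7p2 : (n : ℕ) → n ≥ 1 →
    𝔼[X 2 ] (K 1 3 □ P n)
    ≡ (+ 2254219 / 1411200)
    + (+ 6 / 49) * 2^- (3 *ℕ n)
    - (+ 2 / 225) * 2^- (4 *ℕ n)
    + (+ 11933 / 13440) * (+ n / 1)
corollary7p2 (suc n) (s≤s z≤n) =
  -- 1411200 is a common denominator: 172800, 12544 and 1252965 are its multiples by 6/49, 2/225 and
  -- 11933/13440. The fractions over it reduce to the stated ones by evaluation.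
  mean-from-total {1411200} {2254219} {172800} {12544} {1252965} {total (suc n) (#blocks (grid (suc n)))}
    {#colourings n} {2 ^ suc n} {2 ^ (3 *ℕ suc n)} {suc n}
    {{_}} {{m^n≢0 2 (4 *ℕ suc n)}} {{m^n≢0 2 (3 *ℕ suc n)}}
    (^-distribˡ-+-* 2 (suc n) (3 *ℕ suc n))
    -- 4391835 = 4 * 1411200 - 1252965 is the rank gained per column over the common denominator,
    -- and 13440 = 1411200 / 105.
    (ClosedForm.blockTotal-closed {1411200} {2254219} {172800} {4391835} {12544} {1252965} {13440}
      refl refl refl refl refl refl refl n)
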